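{- Let $n\ge 2$, let $\mathcal{P}\subseteq\mathscr{B}(n)$ be an intersecting family of permutations and define $\mathcal{A}=\mathrm{ID}(\min(\mathcal{P}))$. Then $\mathcal{P}$ is maximum (i.e. has the largest cardinality among all intersecting families in $\mathscr{B}(n)$) if and only if $\mathcal{A}$ is a maximal intersecting antichain and $\mathcal{P}=\mathscr{P}(\mathcal{A})$.
   Context: $\mathscr{B}(n)=(\mathrm{Sym}(n),\preceq)$ is the (right) weak Bruhat lattice. A permutation is written $p=p_1p_2\cdots p_n$, meaning $p(i)=p_i$. The order $\preceq$ is generated by the covering relation: $q$ covers $p$ if, for some $i\in\{1,\dots,n-1\}$, $p_i<p_{i+1}$, $q_i=p_{i+1}$, $q_{i+1}=p_i$ and $q_k=p_k$ for all other $k$. The least element is the identity, and rank is distance from the identity. Let $g_i=(i,i+1)$ for $1\le i<n$ and $\mathbf{G}_n=\{g_1,\dots,g_{n-1}\}$. The inverse descent set of $p$ is $\mathrm{ID}(p)=\{g_i \mid i+1 \text{ precedes } i \text{ in } p_1p_2\cdots p_n\}$, and for a family $\mathcal{P}$, $\mathrm{ID}(\mathcal{P})=\{\mathrm{ID}(p)\mid p\in\mathcal{P}\}$. A family $\mathcal{P}\subseteq\mathscr{B}(n)$ is intersecting if $\mathrm{rank}(x\wedge y)\ge 1$ for all $x,y\in\mathcal{P}$ (including $x=y$). A system of sets is intersecting if $A\cap B\ne\emptyset$ for all members $A,B$ (including $A=B$). $\min(\mathcal{P})$ is the set of $\preceq$-minimal elements of $\mathcal{P}$. For $A\subseteq\mathbf{G}_n$,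 $\pi(A)=\bigvee_{g_i\in A}g_i$ (join in $\mathscr{B}(n)$). For a family $\mathcal{F}$, $\mathrm{up}(\mathcal{F})=\{z\mid x\preceq z\text{ for some }x\in\mathcal{F}\}$. For a system $\mathcal{A}$ of subsets of $\mathbf{G}_n$, $\mathscr{P}(\mathcal{A})=\mathrm{up}(\{\pi(A)\mid A\in\mathcal{A}\})$. A system $\mathcal{A}$ of subsets of $\mathbf{G}_n$ is a maximal intersecting antichain if it is intersecting, it is an antichain under inclusion, and for every $B\subseteq\mathbf{G}_n$ with $B\notin\mathcal{A}$ there is $A\in\mathcal{A}$ such that $A\cap B=\emptyset$ or $A\subseteq B$. -}

module Defs where

open import Data.Fin.Base using (Fin; suc; inject₁; _<_)
open import Data.Fin.Permutation
  using (Permutation′; _⟨$⟩ʳ_; _⟨$⟩ˡ_; _≈_; id; transpose)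
open import Data.Fin.Properties using (_<?_)
import Data.Fin.Subset as Subset
open import Data.Fin.Subset using (Subset; Nonempty; Empty)
open import Data.List.Base using (List; length)
import Data.List.Membership.Setoid as Membership
import Data.List.Relation.Unary.Unique.Setoid as Uniqueness
open import Data.Nat.Base using (ℕ; zero; suc; pred; _≤_)
open import Data.Product.Base using (∃; _×_)
open import Data.Sum.Base using (_⊎_)
open import Data.Vec.Base using (tabulate)
open import Level using (0ℓ)
open import Relation.Binary.Bundles using (Setoid)
open import Relation.Binary.Construct.Closure.ReflexiveTransitive using (Star)
open import Relation.Binary.Construct.Closure.Symmetric using (SymClosure)
open import Relation.Binary.Construct.Union using (_∪_)
open import Relation.Binary.PropositionalEquality using (_≡_; _≢_; refl; sym; trans)
open import Relation.Nullary.Decidable using (does)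
open import Relation.Unary using (Pred; _∈_; _∉_)

private
  variable
    n : ℕ

-- Everything is 0-based: the word of p is p ⟨$⟩ʳ 0, …, p ⟨$⟩ʳ (n-1), and
-- p ⟨$⟩ˡ v is the position of the letter v in it.  Permutations are compared
-- with the pointwise equality _≈_, since they carry proofs of invertibility.

permSetoid : ℕ → Setoid 0ℓ 0ℓ
permSetoid n = record
  { Carrier       = Permutation′ n
  ; _≈_           = _≈_
  ; isEquivalence = record
    { refl  = λ i → refl
    ; sym   = λ p≈q i → sym (p≈q i)
    ; trans = λ p≈q q≈r i → trans (p≈q i) (q≈r i)
    }
  }

-- An index i : Fin (pred n) stands for the adjacent pair (lo i , hi i) of
-- elements of Fin n.

lo hi : Fin (pred n) → Fin n
lo {suc n} i = inject₁ i
hi {suc n} i = suc i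

------------------------------------------------------------------------
-- The weak order

infix 4 _⋖_ _≼_

-- p ⋖ q: q covers p.
_⋖_ : Permutation′ n → Permutation′ n → Set
_⋖_ {n} p q = ∃ λ (i : Fin (pred n)) →
    (p ⟨$⟩ʳ lo i) < (p ⟨$⟩ʳ hi i)
  × q ⟨$⟩ʳ lo i ≡ p ⟨$⟩ʳ hi i
  × q ⟨$⟩ʳ hi i ≡ p ⟨$⟩ʳ lo i
  × (∀ k → k ≢ lo i → k ≢ hi i → q ⟨$⟩ʳ k ≡ p ⟨$⟩ʳ k)

-- The union with _≈_ makes the generated preorder reflexive with respect to
-- pointwise equality.
_≼_ : Permutation′ n → Permutation′ n → Set
_≼_ = Star (_≈_ ∪ _⋖_)

IsMeet : Permutation′ n → Permutation′ n → Permutation′ n → Set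
IsMeet x y m = m ≼ x × m ≼ y × (∀ k → k ≼ x → k ≼ y → k ≼ m)

IsJoin : Pred (Permutation′ n) 0ℓ → Permutation′ n → Set
IsJoin S j = (∀ x → x ∈ S → x ≼ j) × (∀ u → (∀ x → x ∈ S → x ≼ u) → j ≼ u)

-- Walks of a given length in the (undirected) Hasse diagram.
data Walk : ℕ → Permutation′ n → Permutation′ n → Set where
  stop : {p q : Permutation′ n} → p ≈ q → Walk zero p q
  step : {k : ℕ} {p q r : Permutation′ n} →
         SymClosure _⋖_ p q → Walk k q r → Walk (suc k) p r

HasRank : Permutation′ n → ℕ → Set
HasRank p k = Walk k id p × (∀ l → Walk l id p → k ≤ l)

------------------------------------------------------------------------
-- Families of permutations

-- A finite set of permutations, as a list without repetitions up to _≈_.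
record Family (n : ℕ) : Set where
  open Uniqueness (permSetoid n) using (Unique)
  field
    elements : List (Permutation′ n)
    unique   : Unique elements

open Family public

⟦_⟧ : Family n → Pred (Permutation′ n) 0ℓ
⟦_⟧ {n} P p = Membership._∈_ (permSetoid n) p (elements P)

card : Family n → ℕ
card P = length (elements P)

IntersectingFamily : Family n → Set
IntersectingFamily P = ∀ x y → x ∈ ⟦ P ⟧ → y ∈ ⟦ P ⟧ →
  ∃ λ m → IsMeet x y m × ∃ λ k → HasRank m k × 1 ≤ k

Maximum : Family n → Set
Maximum {n} P = IntersectingFamily P ×
  (∀ (Q : Family n) → IntersectingFamily Q → card Q ≤ card P)

minimals : Pred (Permutation′ n) 0ℓ → Pred (Permutation′ n) 0ℓ
minimals F p = p ∈ F × (∀ q → q ∈ F → q ≼ p → q ≈ p)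

up : Pred (Permutation′ n) 0ℓ → Pred (Permutation′ n) 0ℓ
up F z = ∃ λ x → x ∈ F × x ≼ z

------------------------------------------------------------------------
-- Sets of generators

gen : Fin (pred n) → Permutation′ n
gen i = transpose (lo i) (hi i)

-- A set of adjacent transpositions is given by the set of their indices.
GenSet : ℕ → Set
GenSet n = Subset (pred n)

-- A system of such sets.
System : ℕ → Set₁
System n = Pred (GenSet n) 0ℓ

ID : Permutation′ n → GenSet n
ID p = tabulate λ i → does ((p ⟨$⟩ˡ hi i) <? (p ⟨$⟩ˡ lo i))

IDs : Pred (Permutation′ n) 0ℓ → System n
IDs F A = ∃ λ p → p ∈ F × ID p ≡ A

-- x is the join π(A).
Isπ : GenSet n → Permutation′ n → Set
Isπ A = IsJoin (λ x → ∃ λ i → i Subset.∈ A × x ≈ gen i)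

𝒫 : System n → Pred (Permutation′ n) 0ℓ
𝒫 𝒜 = up (λ x → ∃ λ A → A ∈ 𝒜 × Isπ A x)

record MaximalIntersectingAntichain {m : ℕ} (𝒜 : Pred (Subset m) 0ℓ) : Set where
  field
    intersecting : ∀ A B → A ∈ 𝒜 → B ∈ 𝒜 → Nonempty (A Subset.∩ B)
    antichain    : ∀ A B → A ∈ 𝒜 → B ∈ 𝒜 → A Subset.⊆ B → A ≡ B
    maximal      : ∀ B → B ∉ 𝒜 →
                   ∃ λ A → A ∈ 𝒜 × (Empty (A Subset.∩ B) ⊎ A Subset.⊆ B)

{-# OPTIONS --safe #-}

-- In terms of inversion sets, x ∧ y ≠ id iff ID(x) and ID(y) have a common
-- element, and the reversal of the word of p has inverse descent set the
-- complement of ID(p).  An intersecting family therefore contains at most one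
-- of p and its reversal, and it is maximum iff it contains exactly one of them
-- for every p: if it contains neither, one of the two can be added, and if it
-- contains one of each pair, any other intersecting family injects into it.
-- The first condition makes the family closed under enlarging ID(p), hence
-- generated by its minimal elements, which are the π(A) with A minimal in
-- ID(𝒫); maximality of 𝒜 is the same dichotomy read off on p = π(B).

module Submission where

open import Defs
open import Data.Nat.Base using (ℕ; _≤_)
open import Data.Product.Base using (_×_)
open import Function.Bundles using (_⇔_)
open import Relation.Unary using (_≐_)

open import Data.Fin.Base as Fin using (Fin; zero; suc; toℕ; inject₁; opposite; combine; remQuot)
open import Data.Fin.Induction using (<-wellFounded; >-wellFounded)
open import Data.Fin.Permutation
  using (Permutation′; _⟨$⟩ʳ_; _⟨$⟩ˡ_; inverseˡ; inverseʳ; _≈_; id; transpose; _∘ₚ_; reverse)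
import Data.Fin.Permutation.Components as Components
open import Data.Fin.Properties as Fin
  using (_≟_; _<?_; <-cmp; <-trans; <-asym; <-irrefl; any?; all?; toℕ-inject₁; toℕ-injective;
         remQuot-combine; opposite-prop)
open import Data.Fin.Subset as Subset using (Subset; Empty)
open import Data.Fin.Subset.Induction using (⊂-wellFounded; ⊃-wellFounded)
open import Data.Fin.Subset.Properties
  using (_∈?_; _⊂?_; ⊆-antisym; x∈p∩q⁺; x∈p∩q⁻; anySubset?; nonempty?)
open import Data.List.Base using (_∷_; lookup)
open import Data.List.Membership.Propositional.Properties using (∈-lookup)
import Data.List.Membership.Setoid as Membership using (find)
import Data.List.Membership.Setoid.Properties as Membership
import Data.List.Relation.Unary.All as All
open import Data.List.Relation.Unary.All.Properties using (¬Any⇒All¬; ¬All⇒Any¬)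
open import Data.List.Relation.Unary.AllPairs using (_∷_)
open import Data.List.Relation.Unary.Any as Any using (here; there)
import Data.List.Relation.Unary.Unique.Setoid as Uniqueness
open import Data.Nat.Base as ℕ using (zero; suc; s≤s; z≤n)
import Data.Nat.Induction as ℕ using (<-wellFounded)
open import Data.Nat.Properties as ℕ using (anyUpTo?)
open import Data.Product.Base using (∃; _,_; proj₁; proj₂)
open import Data.Sum.Base as Sum using (_⊎_; inj₁; inj₂; [_,_]′)
open import Data.Vec.Base using (tabulate)
open import Data.Vec.Properties using (lookup∘tabulate; []=⇒lookup; lookup⇒[]=)
open import Function.Base using (_∘_; _on_)
open import Function.Bundles using (mk⇔)
open import Induction.WellFounded using (Acc; acc)
open import Level using (0ℓ)
open import Relation.Binary.Construct.Closure.ReflexiveTransitive using (ε; _◅_; _◅◅_)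
open import Relation.Binary.Construct.Closure.Symmetric using (SymClosure; fwd; bwd)
open import Relation.Binary.Construct.Closure.Transitive using (TransClosure; [_]; _∷_; _++_)
open import Relation.Binary.Core using (Rel)
open import Relation.Binary.Definitions using (Transitive; Decidable; tri<; tri≈; tri>)
open import Relation.Binary.PropositionalEquality
  using (_≡_; _≢_; refl; sym; trans; cong; subst; subst₂)
open import Relation.Nullary using (¬_; Dec; yes; no; does; contradiction)
open import Relation.Nullary.Decidable
  using (_×-dec_; _⊎-dec_; ¬?; map′; dec-true; decidable-stable)
open import Relation.Unary as Unary using (Pred; _∈_)

private
  variable
    n : ℕ

-- Consecutive elements of `Fin`.

inject₁<suc : (i : Fin n) → inject₁ i Fin.< suc i
inject₁<suc i = s≤s (ℕ.≤-reflexive (toℕ-inject₁ i))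

inject₁≢suc : (i : Fin n) → inject₁ i ≢ suc i
inject₁≢suc i eq = <-irrefl eq (inject₁<suc i)

adjacent : ∀ {i : Fin n} {b : Fin (suc n)} → inject₁ i Fin.< b → ¬ b Fin.< suc i
adjacent {i = i} lo<b b<hi =
  ℕ.<⇒≱ lo<b (subst (_ ≤_) (sym (toℕ-inject₁ i)) (ℕ.s≤s⁻¹ b<hi))

<⇒suc : ∀ {a b : Fin (suc n)} → a Fin.< b →
       ∃ λ i → suc i ≡ b × (a ≡ inject₁ i ⊎ a Fin.< inject₁ i)
<⇒suc {a = a} {suc i} a<b with <-cmp a (inject₁ i)
... | tri< a<lo _ _ = i , refl , inj₂ a<lo
... | tri≈ _ a≡lo _ = i , refl , inj₁ a≡lo
... | tri> _ _ lo<a = contradiction a<b (adjacent lo<a)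

-- Induction on the upper end `b`, splitting off the last step. This extends checks on neighbours to
-- all pairs, both for positions in a word and for letters.
steps⇒all : (R : Rel (Fin (suc n)) 0ℓ) → Transitive R → (∀ i → R (inject₁ i) (suc i)) →
            ∀ {a b} → a Fin.< b → R a b
steps⇒all R R-trans next {a} {b} = go (<-wellFounded b)
  where
  go : ∀ {b} → Acc Fin._<_ b → a Fin.< b → R a b
  go (acc rec) a<b with <⇒suc a<b
  ... | i , refl , inj₁ refl = next i
  ... | i , refl , inj₂ a<lo = R-trans (go (rec (inject₁<suc i)) a<lo) (next i)

-- A strictly increasing `f` with `f i < i` also has `f (f i) < f i`, which starts an infinite
-- descent; dually for `i < f i`.
increasing⇒identity : (f : Fin (suc n) → Fin (suc n)) →
                      (∀ i → f (inject₁ i) Fin.< f (suc i)) → ∀ i → f i ≡ i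
increasing⇒identity f next i with <-cmp (f i) i
... | tri≈ _ eq _ = eq
... | tri< f<i _ _ = contradiction f<i (below (<-wellFounded i))
  where
  below : ∀ {i} → Acc Fin._<_ i → ¬ f i Fin.< i
  below (acc rec) f<i = below (rec f<i) (steps⇒all (Fin._<_ on f) <-trans next f<i)
... | tri> _ _ i<f = contradiction i<f (above (>-wellFounded i))
  where
  above : ∀ {i} → Acc Fin._>_ i → ¬ i Fin.< f i
  above (acc rec) i<f = above (rec i<f) (steps⇒all (Fin._<_ on f) <-trans next i<f)

-- Adjacent transpositions.

swap : Fin n → Permutation′ (suc n)
swap i = transpose (inject₁ i) (suc i)

transpose-cases : (i j k : Fin (suc n)) →
    (k ≡ i × Components.transpose i j k ≡ j)
  ⊎ (k ≡ j × Components.transpose i j k ≡ i)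
  ⊎ (k ≢ i × k ≢ j × Components.transpose i j k ≡ k)
transpose-cases i j k with k ≟ i
... | yes k≡i = inj₁ (k≡i , refl)
... | no k≢i with k ≟ j
...   | yes k≡j = inj₂ (inj₁ (k≡j , refl))
...   | no k≢j = inj₂ (inj₂ (k≢i , k≢j , refl))

swap-inject₁ : (i : Fin n) → swap i ⟨$⟩ʳ inject₁ i ≡ suc i
swap-inject₁ i with transpose-cases (inject₁ i) (suc i) (inject₁ i)
... | inj₁ (_ , eq) = eq
... | inj₂ (inj₁ (lo≡hi , _)) = contradiction lo≡hi (inject₁≢suc i)
... | inj₂ (inj₂ (lo≢lo , _)) = contradiction refl lo≢lo

swap-suc : (i : Fin n) → swap i ⟨$⟩ʳ suc i ≡ inject₁ i
swap-suc i with transpose-cases (inject₁ i) (suc i) (suc i)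
... | inj₁ (hi≡lo , _) = contradiction (sym hi≡lo) (inject₁≢suc i)
... | inj₂ (inj₁ (_ , eq)) = eq
... | inj₂ (inj₂ (_ , hi≢hi , _)) = contradiction refl hi≢hi

swap-other : (i : Fin n) → ∀ k → k ≢ inject₁ i → k ≢ suc i → swap i ⟨$⟩ʳ k ≡ k
swap-other i k k≢lo k≢hi with transpose-cases (inject₁ i) (suc i) k
... | inj₁ (k≡lo , _) = contradiction k≡lo k≢lo
... | inj₂ (inj₁ (k≡hi , _)) = contradiction k≡hi k≢hi
... | inj₂ (inj₂ (_ , _ , eq)) = eq

-- Nothing lies strictly between `inject₁ i` and `suc i`, so a third element compares in the same
-- way with both.
swap⁻¹-mono : (i : Fin n) → ∀ {x y : Fin (suc n)} → x Fin.< y →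
             swap i ⟨$⟩ˡ x Fin.< swap i ⟨$⟩ˡ y ⊎ (x ≡ inject₁ i × y ≡ suc i)
swap⁻¹-mono i {x} {y} x<y
  with transpose-cases (suc i) (inject₁ i) x | transpose-cases (suc i) (inject₁ i) y
... | inj₁ (refl , _) | inj₁ (refl , _) = contradiction x<y (<-irrefl refl)
... | inj₁ (refl , _) | inj₂ (inj₁ (refl , _)) = contradiction x<y (<-asym (inject₁<suc i))
... | inj₁ (refl , eq) | inj₂ (inj₂ (_ , _ , eq′)) =
  inj₁ (subst₂ Fin._<_ (sym eq) (sym eq′) (<-trans (inject₁<suc i) x<y))
... | inj₂ (inj₁ (refl , _)) | inj₁ (refl , _) = inj₂ (refl , refl)
... | inj₂ (inj₁ (refl , _)) | inj₂ (inj₁ (refl , _)) = contradiction x<y (<-irrefl refl)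
... | inj₂ (inj₁ (refl , eq)) | inj₂ (inj₂ (y≢hi , _ , eq′)) with <-cmp y (suc i)
...   | tri< y<hi _ _ = contradiction y<hi (adjacent x<y)
...   | tri≈ _ y≡hi _ = contradiction y≡hi y≢hi
...   | tri> _ _ hi<y = inj₁ (subst₂ Fin._<_ (sym eq) (sym eq′) hi<y)
swap⁻¹-mono i {x} {y} x<y
    | inj₂ (inj₂ (_ , x≢lo , eq)) | inj₁ (refl , eq′) with <-cmp x (inject₁ i)
...   | tri< x<lo _ _ = inj₁ (subst₂ Fin._<_ (sym eq) (sym eq′) x<lo)
...   | tri≈ _ x≡lo _ = contradiction x≡lo x≢lo
...   | tri> _ _ lo<x = contradiction x<y (adjacent lo<x)
swap⁻¹-mono i {x} {y} x<y
    | inj₂ (inj₂ (_ , _ , eq)) | inj₂ (inj₁ (refl , eq′)) =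
  inj₁ (subst₂ Fin._<_ (sym eq) (sym eq′) (<-trans x<y (inject₁<suc i)))
swap⁻¹-mono i {x} {y} x<y
    | inj₂ (inj₂ (_ , _ , eq)) | inj₂ (inj₂ (_ , _ , eq′)) =
  inj₁ (subst₂ Fin._<_ (sym eq) (sym eq′) x<y)

-- Inversions

Before : Permutation′ (suc n) → Rel (Fin (suc n)) 0ℓ
Before p a b = p ⟨$⟩ˡ a Fin.< p ⟨$⟩ˡ b

before? : (p : Permutation′ (suc n)) → Decidable (Before p)
before? p a b = (p ⟨$⟩ˡ a) <? (p ⟨$⟩ˡ b)

⟨$⟩ˡ-injective : (p : Permutation′ (suc n)) → ∀ {a b} → p ⟨$⟩ˡ a ≡ p ⟨$⟩ˡ b → a ≡ b
⟨$⟩ˡ-injective p eq = trans (sym (inverseʳ p)) (trans (cong (p ⟨$⟩ʳ_) eq) (inverseʳ p))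

⟨$⟩ʳ-injective : (p : Permutation′ (suc n)) → ∀ {x y} → p ⟨$⟩ʳ x ≡ p ⟨$⟩ʳ y → x ≡ y
⟨$⟩ʳ-injective p eq = trans (sym (inverseˡ p)) (trans (cong (p ⟨$⟩ˡ_) eq) (inverseˡ p))

before-total : (p : Permutation′ (suc n)) → ∀ {a b} → a ≢ b → Before p a b ⊎ Before p b a
before-total p {a} {b} a≢b with <-cmp (p ⟨$⟩ˡ a) (p ⟨$⟩ˡ b)
... | tri< lt _ _ = inj₁ lt
... | tri≈ _ eq _ = contradiction (⟨$⟩ˡ-injective p eq) a≢b
... | tri> _ _ gt = inj₂ gt

<⇒before : (p : Permutation′ (suc n)) → ∀ {x y} → x Fin.< y → Before p (p ⟨$⟩ʳ x) (p ⟨$⟩ʳ y)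
<⇒before p = subst₂ Fin._<_ (sym (inverseˡ p)) (sym (inverseˡ p))

≈⇒⟨$⟩ˡ : {p q : Permutation′ (suc n)} → p ≈ q → ∀ v → p ⟨$⟩ˡ v ≡ q ⟨$⟩ˡ v
≈⇒⟨$⟩ˡ {p = p} {q} p≈q v = trans (sym (inverseˡ q))
  (cong (q ⟨$⟩ˡ_) (trans (sym (p≈q (p ⟨$⟩ˡ v))) (inverseʳ p)))

before-resp-≈ : {p q : Permutation′ (suc n)} → p ≈ q → ∀ {a b} → Before p a b → Before q a b
before-resp-≈ {p = p} {q} p≈q = subst₂ Fin._<_ (≈⇒⟨$⟩ˡ {p = p} {q} p≈q _) (≈⇒⟨$⟩ˡ {p = p} {q} p≈q _)

infix 4 _⊑_

-- Inclusion of inversion sets, which by `≼⇒⊑` and `⊑⇒≼` is the weak order.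
_⊑_ : Permutation′ (suc n) → Permutation′ (suc n) → Set
p ⊑ q = ∀ {a b} → a Fin.< b → Before p b a → Before q b a

before-swap : (p : Permutation′ (suc n)) (i : Fin n) → ∀ {a b} → Before p a b →
              Before (swap i ∘ₚ p) a b ⊎ (a ≡ p ⟨$⟩ʳ inject₁ i × b ≡ p ⟨$⟩ʳ suc i)
before-swap p i a<b = Sum.map₂
  (λ (eq , eq′) → move eq , move eq′) (swap⁻¹-mono i a<b)
  where
  move : ∀ {v x} → p ⟨$⟩ˡ v ≡ x → v ≡ p ⟨$⟩ʳ x
  move eq = trans (sym (inverseʳ p)) (cong (p ⟨$⟩ʳ_) eq)

⊑-swap : (p : Permutation′ (suc n)) (i : Fin n) →
         (p ⟨$⟩ʳ inject₁ i) Fin.< (p ⟨$⟩ʳ suc i) → p ⊑ swap i ∘ₚ p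
⊑-swap p i ascent a<b before with before-swap p i before
... | inj₁ before′ = before′
... | inj₂ (refl , refl) = contradiction a<b (<-asym ascent)

swap-inverts : (p : Permutation′ (suc n)) (i : Fin n) →
               Before (swap i ∘ₚ p) (p ⟨$⟩ʳ suc i) (p ⟨$⟩ʳ inject₁ i)
swap-inverts p i = subst₂ (Before (swap i ∘ₚ p)) (cong (p ⟨$⟩ʳ_) (swap-inject₁ i))
  (cong (p ⟨$⟩ʳ_) (swap-suc i)) (<⇒before (swap i ∘ₚ p) (inject₁<suc i))

-- The covering condition without the ascent, hence symmetric in `p` and `q`: an undirected edge of
-- the Hasse diagram.
Swapped : Fin n → Permutation′ (suc n) → Permutation′ (suc n) → Set
Swapped i p q = q ⟨$⟩ʳ inject₁ i ≡ p ⟨$⟩ʳ suc i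
              × q ⟨$⟩ʳ suc i ≡ p ⟨$⟩ʳ inject₁ i
              × (∀ k → k ≢ inject₁ i → k ≢ suc i → q ⟨$⟩ʳ k ≡ p ⟨$⟩ʳ k)

swapped-swap : ∀ i (p : Permutation′ (suc n)) → Swapped i p (swap i ∘ₚ p)
swapped-swap i p = cong (p ⟨$⟩ʳ_) (swap-inject₁ i) , cong (p ⟨$⟩ʳ_) (swap-suc i) ,
  λ k k≢lo k≢hi → cong (p ⟨$⟩ʳ_) (swap-other i k k≢lo k≢hi)

swapped⇒≈ : ∀ {i} {p q : Permutation′ (suc n)} → Swapped i p q → swap i ∘ₚ p ≈ q
swapped⇒≈ {i = i} {p} (q-lo , q-hi , q-other) k with transpose-cases (inject₁ i) (suc i) k
... | inj₁ (refl , eq) = trans (cong (p ⟨$⟩ʳ_) eq) (sym q-lo)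
... | inj₂ (inj₁ (refl , eq)) = trans (cong (p ⟨$⟩ʳ_) eq) (sym q-hi)
... | inj₂ (inj₂ (k≢lo , k≢hi , eq)) = trans (cong (p ⟨$⟩ʳ_) eq) (sym (q-other k k≢lo k≢hi))

≼⇒⊑ : {p q : Permutation′ (suc n)} → p ≼ q → p ⊑ q
≼⇒⊑ ε a<b before = before
≼⇒⊑ (_◅_ {i = p} {j = r} (inj₁ p≈r) r≼q) a<b before =
  ≼⇒⊑ r≼q a<b (before-resp-≈ {p = p} {r} p≈r before)
≼⇒⊑ (_◅_ {i = p} {j = r} (inj₂ (i , ascent , swapped)) r≼q) a<b before =
  ≼⇒⊑ r≼q a<b (before-resp-≈ {p = swap i ∘ₚ p} {r} (swapped⇒≈ {p = p} {r} swapped)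
    (⊑-swap p i ascent a<b before))

-- Inversion sets and sorting.

∈-tabulate⁺ : ∀ {m} {P : Pred (Fin m) 0ℓ} (P? : Unary.Decidable P) {i} →
              P i → i Subset.∈ tabulate (does ∘ P?)
∈-tabulate⁺ P? {i} Pi = lookup⇒[]= i _
  (trans (lookup∘tabulate (does ∘ P?) i) (dec-true (P? i) Pi))

∈-tabulate⁻ : ∀ {m} {P : Pred (Fin m) 0ℓ} (P? : Unary.Decidable P) {i} →
              i Subset.∈ tabulate (does ∘ P?) → P i
∈-tabulate⁻ P? {i} i∈ with P? i | trans (sym (lookup∘tabulate (does ∘ P?) i)) ([]=⇒lookup i∈)
... | yes Pi | _ = Pi

Inverted : Permutation′ (suc n) → Pred (Fin (suc n) × Fin (suc n)) 0ℓ
Inverted p (a , b) = a Fin.< b × Before p b a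

inverted? : (p : Permutation′ (suc n)) → Unary.Decidable (Inverted p)
inverted? p (a , b) = a <? b ×-dec before? p b a

-- Pairs are coded as single indices so that strict inclusion of `Subset`s, which is well-founded,
-- can serve as the termination order of `sort`.
inversions : Permutation′ (suc n) → Subset (suc n ℕ.* suc n)
inversions {n} p = tabulate (does ∘ inverted? p ∘ remQuot (suc n))

inversions-⊂ : {p q : Permutation′ (suc n)} → p ⊑ q → ∀ {a b} → a Fin.< b →
               ¬ Before p b a → Before q b a → inversions p Subset.⊂ inversions q
inversions-⊂ {n} {p} {q} p⊑q {a} {b} a<b ¬before before =
  (λ k∈ → let (lt , inv) = ∈-tabulate⁻ (inverted? p ∘ remQuot (suc n)) k∈ in
    ∈-tabulate⁺ (inverted? q ∘ remQuot (suc n)) (lt , p⊑q lt inv)) ,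
  combine a b ,
  ∈-tabulate⁺ (inverted? q ∘ remQuot (suc n))
    (subst (Inverted q) (sym (remQuot-combine a b)) (a<b , before)) ,
  λ k∈ → ¬before (proj₂ (subst (Inverted p) (remQuot-combine a b)
    (∈-tabulate⁻ (inverted? p ∘ remQuot (suc n)) k∈)))

-- Bubble sort towards R: every swap inverts a pair which R inverts, so each
-- swap is a cover, and the process stops at a word sorted by R.
sort : (R : Rel (Fin (suc n)) 0ℓ) → Decidable R → Transitive R →
       (∀ {a b} → a ≢ b → R a b ⊎ R b a) →
       (p : Permutation′ (suc n)) → (∀ {a b} → a Fin.< b → Before p b a → R b a) →
       ∃ λ q → p ≼ q × (∀ {a b} → Before q a b → R a b)
sort {n} R R? R-trans R-total p = go p (⊃-wellFounded (inversions p))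
  where
  go : ∀ p → Acc Subset._⊃_ (inversions p) → (∀ {a b} → a Fin.< b → Before p b a → R b a) →
       ∃ λ q → p ≼ q × (∀ {a b} → Before q a b → R a b)
  go p (acc rec) compatible with any? (λ i →
    ((p ⟨$⟩ʳ inject₁ i) <? (p ⟨$⟩ʳ suc i)) ×-dec R? (p ⟨$⟩ʳ suc i) (p ⟨$⟩ʳ inject₁ i))
  ... | yes (i , ascent , Rhi-lo) =
    let (q , p′≼q , sorted) = go (swap i ∘ₚ p) (rec (inversions-⊂ {p = p} {swap i ∘ₚ p}
          (⊑-swap p i ascent) ascent
          (<-asym (<⇒before p (inject₁<suc i))) (swap-inverts p i)))
          compatible′
    in q , inj₂ (i , ascent , swapped-swap i p) ◅ p′≼q , sorted
    where
    compatible′ : ∀ {a b} → a Fin.< b → Before (swap i ∘ₚ p) b a → R b a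
    -- An inversion of the swapped word is one of `p` or the pair just exchanged, which is in `R`
    -- order by the choice of `i`.
    compatible′ a<b before with before-total p (λ a≡b → <-irrefl a≡b a<b)
    ... | inj₂ b-a = compatible a<b b-a
    ... | inj₁ a-b with before-swap p i a-b
    ...   | inj₁ before′ = contradiction before (<-asym before′)
    ...   | inj₂ (refl , refl) = Rhi-lo
  ... | no none = p , ε , λ {a} {b} before → subst₂ R (inverseʳ p) (inverseʳ p)
    (steps⇒all (R on (p ⟨$⟩ʳ_)) R-trans next before)
    where
    next : ∀ i → R (p ⟨$⟩ʳ inject₁ i) (p ⟨$⟩ʳ suc i)
    -- A descent is in `R` order by compatibility, an ascent because no swap is left.
    next i with <-cmp (p ⟨$⟩ʳ inject₁ i) (p ⟨$⟩ʳ suc i)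
    ... | tri> _ _ descent = compatible descent (<⇒before p (inject₁<suc i))
    ... | tri≈ _ eq _ = contradiction (⟨$⟩ʳ-injective p eq) (inject₁≢suc i)
    ... | tri< ascent p-lo≢p-hi _ with R-total p-lo≢p-hi
    ...   | inj₁ Rlo-hi = Rlo-hi
    ...   | inj₂ Rhi-lo = contradiction (i , ascent , Rhi-lo) none

-- The map sending `i` to `q ⟨$⟩ˡ (p ⟨$⟩ʳ i)` is strictly increasing, hence the identity.
before⇒≈ : {p q : Permutation′ (suc n)} → (∀ {a b} → Before p a b → Before q a b) → p ≈ q
before⇒≈ {p = p} {q} before i = trans (sym (inverseʳ q)) (cong (q ⟨$⟩ʳ_)
  (increasing⇒identity (λ i → q ⟨$⟩ˡ (p ⟨$⟩ʳ i)) (λ i → before (<⇒before p (inject₁<suc i))) i))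

-- Sort `p` towards the letter order of `q`; the compatibility that `sort` asks for is `p ⊑ q`
-- itself.
⊑⇒≼ : {p q : Permutation′ (suc n)} → p ⊑ q → p ≼ q
⊑⇒≼ {p = p} {q} p⊑q =
  let (r , p≼r , sorted) = sort (Before q) (before? q) <-trans (before-total q) p p⊑q
  in p≼r ◅◅ inj₁ (before⇒≈ {p = r} {q} sorted) ◅ ε

≼-antisym : {p q : Permutation′ (suc n)} → p ≼ q → q ≼ p → p ≈ q
≼-antisym {p = p} {q} p≼q q≼p = before⇒≈ {p = p} {q} before
  where
  before : ∀ {a b} → Before p a b → Before q a b
  before {a} {b} p-a-b with <-cmp a b
  ... | tri≈ _ refl _ = contradiction p-a-b (<-irrefl refl)
  ... | tri> _ _ b<a = ≼⇒⊑ p≼q b<a p-a-b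
  ... | tri< a<b a≢b _ with before-total q a≢b
  ...   | inj₁ q-a-b = q-a-b
  ...   | inj₂ q-b-a = contradiction p-a-b (<-asym (≼⇒⊑ q≼p a<b q-b-a))

id-least : (p : Permutation′ (suc n)) → id ≼ p
id-least p = ⊑⇒≼ {p = id} {p} λ a<b b<a → contradiction b<a (<-asym a<b)

-- Permutations with a prescribed set of noninversions, and meets.

module _ (E : Rel (Fin (suc n)) 0ℓ) (E? : Decidable E)
         (E⇒< : ∀ {a b : Fin (suc n)} → E a b → a Fin.< b)
         (E-cotrans : ∀ {a b c : Fin (suc n)} → a Fin.< b → b Fin.< c → E a c → E a b ⊎ E b c) where

  private
    E⁺ : Rel (Fin (suc n)) 0ℓ
    E⁺ = TransClosure E

  E⁺⇒< : ∀ {a b} → E⁺ a b → a Fin.< b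
  E⁺⇒< [ e ] = E⇒< e
  E⁺⇒< (e ∷ es) = <-trans (E⇒< e) (E⁺⇒< es)

  -- Chains of `E` strictly increase, so a search by first edge terminates.
  E⁺? : Decidable E⁺
  E⁺? a b = go a (>-wellFounded a)
    where
    go : ∀ a → Acc Fin._>_ a → Dec (E⁺ a b)
    go a (acc rec) with E? a b
    ... | yes e = yes [ e ]
    ... | no ¬e = map′ (λ (c , e , es) → e ∷ es)
        (λ { [ e ] → contradiction e ¬e ; (e ∷ es) → _ , e , es })
        (any? decide)
      where
      decide : ∀ c → Dec (E a c × E⁺ c b)
      -- The edge is decided first, since the recursive call needs the bound `a < c` that it gives.
      decide c with E? a c
      ... | no ¬e = no (¬e ∘ proj₁)
      ... | yes e = map′ (e ,_) proj₂ (go c (rec (E⇒< e)))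

  -- Follow the chain to the edge that jumps over `b` and split that edge; if the chain passes
  -- through `b`, cut it there.
  E⁺-cotrans : ∀ {a b c} → a Fin.< b → b Fin.< c → E⁺ a c → E⁺ a b ⊎ E⁺ b c
  E⁺-cotrans a<b b<c [ e ] = Sum.map [_] [_] (E-cotrans a<b b<c e)
  E⁺-cotrans {b = b} a<b b<c (_∷_ {y = d} e es) with <-cmp b d
  ... | tri< b<d _ _ = Sum.map [_] (_∷ es) (E-cotrans a<b b<d e)
  ... | tri≈ _ refl _ = inj₂ es
  ... | tri> _ _ d<b = Sum.map₁ (e ∷_) (E⁺-cotrans d<b b<c es)

  -- A permutation is determined by its noninversions, and the transitive
  -- closure of E is a possible set of noninversions because it is transitive
  -- and cotransitive.
  realise : ∃ λ m → (∀ {a b} → E⁺ a b → Before m a b)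
                  × (∀ {a b} → a Fin.< b → Before m a b → E⁺ a b)
  realise =
    -- The identity has no inversions, so it is compatible with every `R`.
    let (m , _ , sorted) = sort R R? R-trans R-total id
                             (λ a<b b<a → contradiction b<a (<-asym a<b))
    in m , noninversion {m} sorted ,
       λ a<b before → [ (λ es → es) , (λ (b<a , _) → contradiction b<a (<-asym a<b)) ]′
         (sorted before)
    where
    R : Rel (Fin (suc n)) 0ℓ
    R a b = E⁺ a b ⊎ (b Fin.< a × ¬ E⁺ b a)

    R? : Decidable R
    R? a b = E⁺? a b ⊎-dec (b <? a ×-dec ¬? (E⁺? b a))

    R-total : ∀ {a b} → a ≢ b → R a b ⊎ R b a
    R-total {a} {b} a≢b with <-cmp a b
    ... | tri≈ _ a≡b _ = contradiction a≡b a≢b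
    ... | tri< a<b _ _ with E⁺? a b
    ...   | yes es = inj₁ (inj₁ es)
    ...   | no ¬es = inj₂ (inj₂ (a<b , ¬es))
    R-total {a} {b} a≢b | tri> _ _ b<a with E⁺? b a
    ...   | yes es = inj₂ (inj₁ es)
    ...   | no ¬es = inj₁ (inj₂ (b<a , ¬es))

    R-trans : Transitive R
    R-trans (inj₁ es) (inj₁ fs) = inj₁ (es ++ fs)
    R-trans (inj₂ (b<a , ¬es)) (inj₂ (c<b , ¬fs)) =
      inj₂ (<-trans c<b b<a , [ ¬fs , ¬es ]′ ∘ E⁺-cotrans c<b b<a)
    -- In both mixed cases transitivity of `E⁺` settles `c < a` and cotransitivity settles `a < c`.
    R-trans {a} {b} {c} (inj₁ es) (inj₂ (c<b , ¬fs)) with <-cmp a c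
    ... | tri≈ _ refl _ = contradiction es ¬fs
    ... | tri> _ _ c<a = inj₂ (c<a , λ gs → ¬fs (gs ++ es))
    ... | tri< a<c _ _ = inj₁
      ([ (λ gs → gs) , (λ gs → contradiction gs ¬fs) ]′ (E⁺-cotrans a<c c<b es))
    R-trans {a} {b} {c} (inj₂ (b<a , ¬es)) (inj₁ fs) with <-cmp a c
    ... | tri≈ _ refl _ = contradiction fs ¬es
    ... | tri> _ _ c<a = inj₂ (c<a , λ gs → ¬es (fs ++ gs))
    ... | tri< a<c _ _ = inj₁
      ([ (λ gs → contradiction gs ¬es) , (λ gs → gs) ]′ (E⁺-cotrans b<a a<c fs))

    noninversion : ∀ {m} → (∀ {a b} → Before m a b → R a b) → ∀ {a b} → E⁺ a b → Before m a b
    noninversion {m} sorted {a} {b} es with before-total m (λ a≡b → <-irrefl a≡b (E⁺⇒< es))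
    ... | inj₁ before = before
    ... | inj₂ before with sorted before
    ...   | inj₁ fs = contradiction (E⁺⇒< fs) (<-asym (E⁺⇒< es))
    ...   | inj₂ (_ , ¬es) = contradiction es ¬es

before-cotrans : (p : Permutation′ (suc n)) → ∀ {a c} b → Before p a c → Before p a b ⊎ Before p b c
before-cotrans p {a} {c} b a-c with before? p a b
... | yes a-b = inj₁ a-b
... | no ¬a-b = inj₂ (ℕ.≤-<-trans (ℕ.≮⇒≥ ¬a-b) a-c)

-- Classically, a pair is a noninversion of x ∧ y iff it is joined by an
-- increasing chain of pairs each of which is a noninversion of x or of y.
meet : (x y : Permutation′ (suc n)) → ∃ (IsMeet x y)
meet {n} x y =
  let (m , E⁺⇒m , m⇒E⁺) = realise E E? proj₁ E-cotrans
      below : ∀ z → (∀ {a b} → Before z a b → Before x a b ⊎ Before y a b) → m ⊑ z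
      below z z⇒xy {a} {b} a<b m-b-a = [ (λ z-a-b → contradiction m-b-a
        (<-asym (E⁺⇒m [ a<b , z⇒xy z-a-b ]))) , (λ z-b-a → z-b-a) ]′
        (before-total z (λ a≡b → <-irrefl a≡b a<b))
  in m , ⊑⇒≼ {p = m} {x} (below x inj₁) , ⊑⇒≼ {p = m} {y} (below y inj₂) ,
     -- If `m` had `a` before `b`, an `E`-chain would join them. All inversions of `k` are
     -- inversions of both `x` and `y`, so `k` keeps every edge, and hence the chain, in order.
     λ k k≼x k≼y → ⊑⇒≼ {p = k} {m} λ a<b k-b-a →
       [ (λ m-a-b → contradiction k-b-a
           (<-asym (closure k (edge k (≼⇒⊑ k≼x) (≼⇒⊑ k≼y)) (m⇒E⁺ a<b m-a-b))))
       , (λ m-b-a → m-b-a) ]′ (before-total m (λ a≡b → <-irrefl a≡b a<b))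
  where
  E : Rel (Fin (suc n)) 0ℓ
  E a b = a Fin.< b × (Before x a b ⊎ Before y a b)

  E? : Decidable E
  E? a b = a <? b ×-dec (before? x a b ⊎-dec before? y a b)

  E-cotrans : ∀ {a b c} → a Fin.< b → b Fin.< c → E a c → E a b ⊎ E b c
  E-cotrans {b = b} a<b b<c (_ , inj₁ x-a-c) =
    Sum.map ((a<b ,_) ∘ inj₁) ((b<c ,_) ∘ inj₁) (before-cotrans x b x-a-c)
  E-cotrans {b = b} a<b b<c (_ , inj₂ y-a-c) =
    Sum.map ((a<b ,_) ∘ inj₂) ((b<c ,_) ∘ inj₂) (before-cotrans y b y-a-c)

  edge : ∀ k → k ⊑ x → k ⊑ y → ∀ {a b} → E a b → Before k a b
  edge k k⊑x k⊑y {a} {b} (a<b , before) with before-total k (λ a≡b → <-irrefl a≡b a<b)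
  ... | inj₁ k-a-b = k-a-b
  ... | inj₂ k-b-a = contradiction before
    [ <-asym (k⊑x a<b k-b-a) , <-asym (k⊑y a<b k-b-a) ]′

  closure : ∀ k → (∀ {a b} → E a b → Before k a b) → ∀ {a b} → TransClosure E a b → Before k a b
  closure k E⇒k [ e ] = E⇒k e
  closure k E⇒k (e ∷ es) = <-trans (E⇒k e) (closure k E⇒k es)

-- Descents and the permutations π(A)

∈ID⁺ : (p : Permutation′ (suc n)) → ∀ {i} → Before p (suc i) (inject₁ i) → i Subset.∈ ID p
∈ID⁺ p = ∈-tabulate⁺ (λ i → before? p (suc i) (inject₁ i))

∈ID⁻ : (p : Permutation′ (suc n)) → ∀ {i} → i Subset.∈ ID p → Before p (suc i) (inject₁ i)
∈ID⁻ p = ∈-tabulate⁻ (λ i → before? p (suc i) (inject₁ i))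

∉ID⁻ : (p : Permutation′ (suc n)) → ∀ {i} → ¬ i Subset.∈ ID p → Before p (inject₁ i) (suc i)
∉ID⁻ p {i} i∉ = [ (λ before → before) , (λ before → contradiction (∈ID⁺ p before) i∉) ]′
  (before-total p (inject₁≢suc i))

≼⇒ID⊆ : {p q : Permutation′ (suc n)} → p ≼ q → ID p Subset.⊆ ID q
≼⇒ID⊆ {p = p} {q} p≼q {i} i∈ = ∈ID⁺ q (≼⇒⊑ p≼q (inject₁<suc i) (∈ID⁻ p i∈))

≈⇒≼ : {p q : Permutation′ (suc n)} → p ≈ q → p ≼ q
≈⇒≼ p≈q = inj₁ p≈q ◅ ε

ID-swap : (i : Fin n) → i Subset.∈ ID (swap i)
ID-swap i = ∈ID⁺ (swap i) (subst₂ (Before (swap i)) (swap-inject₁ i) (swap-suc i)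
  (<⇒before (swap i) (inject₁<suc i)))

-- The only inversion of `swap i` is the pair that it exchanges.
∈ID⇒swap≼ : (p : Permutation′ (suc n)) → ∀ {i} → i Subset.∈ ID p → swap i ≼ p
∈ID⇒swap≼ p {i} i∈ = ⊑⇒≼ {p = swap i} {p} λ a<b before →
  [ (λ before′ → contradiction before (<-asym before′))
  , (λ { (refl , refl) → ∈ID⁻ p i∈ }) ]′ (swap⁻¹-mono i a<b)

-- a < b is a noninversion of π(A) iff one of the adjacent pairs from a to b
-- does not belong to A.
π-exists : (A : Subset n) → ∃ λ p → ID p ≡ A × (∀ q → A Subset.⊆ ID q → p ≼ q)
π-exists {n} A =
  let (p , E⁺⇒p , p⇒E⁺) = realise E E? E⇒< E-cotrans
      ID⊆A : ID p Subset.⊆ A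
      ID⊆A {i} i∈ = decidable-stable (i ∈? A) λ i∉A → <-asym (∈ID⁻ p i∈)
        (E⁺⇒p [ i , i∉A , ℕ.≤-refl , ℕ.≤-refl ])
      A⊆ID : A Subset.⊆ ID p
      A⊆ID {i} i∈A = decidable-stable (i ∈? ID p) λ i∉ID →
        -- A chain across an adjacent pair collapses to one edge, whose witness `j` is squeezed
        -- between `i` and `i`.
        let (j , j∉A , i≤j , j≤i) = E⁺⇒E (p⇒E⁺ (inject₁<suc i) (∉ID⁻ p i∉ID))
        in j∉A (subst (Subset._∈ A) (toℕ-injective (ℕ.≤-antisym
             (subst₂ _≤_ (toℕ-inject₁ i) (toℕ-inject₁ j) i≤j) (ℕ.s≤s⁻¹ j≤i))) i∈A)
  -- If `A` lies in `ID q`, every adjacent pair is in `E` or inverted by `q`, and this alternative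
  -- passes to all pairs. A pair inverted by `p` is not in `E`, so `q` inverts it.
  in p , ⊆-antisym ID⊆A A⊆ID , λ q A⊆ID → ⊑⇒≼ {p = p} {q} λ {a} {b} a<b p-b-a →
       [ (λ e → contradiction p-b-a (<-asym (E⁺⇒p [ e ]))) , (λ q-b-a → q-b-a) ]′
       (proj₂ (steps⇒all (E-or-inverted q) (E-or-inverted-trans q) (next q A⊆ID) a<b))
  where
  E : Rel (Fin (suc n)) 0ℓ
  E a b = ∃ λ i → ¬ i Subset.∈ A × a Fin.≤ inject₁ i × suc i Fin.≤ b

  E? : Decidable E
  E? a b = any? λ i → ¬? (i ∈? A) ×-dec (a Fin.≤? inject₁ i ×-dec suc i Fin.≤? b)

  E⇒< : ∀ {a b} → E a b → a Fin.< b
  E⇒< (i , _ , a≤i , i<b) = ℕ.≤-<-trans a≤i (ℕ.<-≤-trans (inject₁<suc i) i<b)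

  E-cotrans : ∀ {a b c} → a Fin.< b → b Fin.< c → E a c → E a b ⊎ E b c
  E-cotrans {a} {b} {c} _ _ (i , i∉A , a≤i , i<c) with ℕ.<-≤-connex (toℕ i) (toℕ b)
  ... | inj₁ i<b = inj₁ (i , i∉A , a≤i , i<b)
  ... | inj₂ b≤i = inj₂ (i , i∉A , subst (toℕ b ≤_) (sym (toℕ-inject₁ i)) b≤i , i<c)

  E-extendʳ : ∀ {a b c} → b Fin.< c → E a b → E a c
  E-extendʳ b<c (i , i∉A , a≤i , i<b) = i , i∉A , a≤i , ℕ.≤-trans i<b (ℕ.<⇒≤ b<c)

  E-extendˡ : ∀ {a b c} → a Fin.< b → E b c → E a c
  E-extendˡ a<b (i , i∉A , b≤i , i<c) = i , i∉A , ℕ.≤-trans (ℕ.<⇒≤ a<b) b≤i , i<c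

  -- Widening the interval keeps the witness, so `E` is already transitive.
  E⁺⇒E : ∀ {a b} → TransClosure E a b → E a b
  E⁺⇒E [ e ] = e
  E⁺⇒E (e ∷ es) = E-extendˡ (E⇒< e) (E⁺⇒E es)

  E-or-inverted : Permutation′ (suc n) → Rel (Fin (suc n)) 0ℓ
  E-or-inverted q a b = a Fin.< b × (E a b ⊎ Before q b a)

  E-or-inverted-trans : ∀ q → Transitive (E-or-inverted q)
  E-or-inverted-trans q (a<b , inj₁ e) (b<c , _) = <-trans a<b b<c , inj₁ (E-extendʳ b<c e)
  E-or-inverted-trans q (a<b , inj₂ _) (b<c , inj₁ f) = <-trans a<b b<c , inj₁ (E-extendˡ a<b f)
  E-or-inverted-trans q (a<b , inj₂ b-a) (b<c , inj₂ c-b) =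
    <-trans a<b b<c , inj₂ (<-trans c-b b-a)

  next : ∀ q → A Subset.⊆ ID q → ∀ i → E-or-inverted q (inject₁ i) (suc i)
  next q A⊆ID i with i ∈? A
  ... | yes i∈A = inject₁<suc i , inj₂ (∈ID⁻ q (A⊆ID i∈A))
  ... | no i∉A = inject₁<suc i , inj₁ (i , i∉A , ℕ.≤-refl , ℕ.≤-refl)

π : Subset n → Permutation′ (suc n)
π A = proj₁ (π-exists A)

ID-π : (A : Subset n) → ID (π A) ≡ A
ID-π A = proj₁ (proj₂ (π-exists A))

π-least : (A : Subset n) (q : Permutation′ (suc n)) → A Subset.⊆ ID q → π A ≼ q
π-least A = proj₂ (proj₂ (π-exists A))

-- The upper bounds of the generators in `A` are the `u` with `A` contained in `ID u`, and `π A` is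
-- the least of these.
Isπ-π : (A : Subset n) → Isπ A (π A)
Isπ-π A =
  (λ x (i , i∈A , x≈) → ≈⇒≼ {p = x} {swap i} x≈ ◅◅
    ∈ID⇒swap≼ (π A) (subst (i Subset.∈_) (sym (ID-π A)) i∈A)) ,
  λ u bound → π-least A u λ {i} i∈A →
    ≼⇒ID⊆ (bound (swap i) (i , i∈A , λ _ → refl)) (ID-swap i)

Isπ⇒⊆ID : {A : Subset n} {x : Permutation′ (suc n)} → Isπ A x → A Subset.⊆ ID x
Isπ⇒⊆ID (upper , _) {i} i∈A = ≼⇒ID⊆ (upper (swap i) (i , i∈A , λ _ → refl)) (ID-swap i)

-- Reversal of words.

reversed : Permutation′ n → Permutation′ n
reversed p = reverse ∘ₚ p

opposite-antitone : {x y : Fin n} → x Fin.< y → opposite y Fin.< opposite x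
opposite-antitone {suc n} {x} {y} x<y = subst₂ ℕ._<_ (sym (opposite-prop y)) (sym (opposite-prop x))
  (ℕ.∸-monoʳ-< x<y (Fin.toℕ≤pred[n] y))

-- Reversal flips the relative order of any two letters; with `ID-reversed⁻`, the inverse descent
-- set becomes its complement.
ID-reversed⁺ : (p : Permutation′ (suc n)) → ∀ {i} → ¬ i Subset.∈ ID p → i Subset.∈ ID (reversed p)
ID-reversed⁺ p i∉ = ∈ID⁺ (reversed p) (opposite-antitone (∉ID⁻ p i∉))

ID-reversed⁻ : (p : Permutation′ (suc n)) → ∀ {i} → i Subset.∈ ID (reversed p) → ¬ i Subset.∈ ID p
ID-reversed⁻ p i∈rev i∈ = <-asym (opposite-antitone (∈ID⁻ p i∈)) (∈ID⁻ (reversed p) i∈rev)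

-- Rank

adjacent⇒swapped : {p q : Permutation′ (suc n)} → SymClosure _⋖_ p q → ∃ λ i → Swapped i p q
adjacent⇒swapped (fwd (i , _ , swapped)) = i , swapped
adjacent⇒swapped (bwd (i , _ , p-lo , p-hi , p-other)) =
  i , sym p-hi , sym p-lo , λ k k≢lo k≢hi → sym (p-other k k≢lo k≢hi)

-- The order of the two exchanged letters decides which of `p` and `q` is the cover.
swapped⇒adjacent : ∀ {i} (p q : Permutation′ (suc n)) → Swapped i p q → SymClosure _⋖_ p q
swapped⇒adjacent {i = i} p q (q-lo , q-hi , q-other)
  with <-cmp (p ⟨$⟩ʳ inject₁ i) (p ⟨$⟩ʳ suc i)
... | tri< ascent _ _ = fwd (i , ascent , q-lo , q-hi , q-other)
... | tri≈ _ eq _ = contradiction (⟨$⟩ʳ-injective p eq) (inject₁≢suc i)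
... | tri> _ _ descent = bwd (i , subst₂ Fin._<_ (sym q-lo) (sym q-hi) descent ,
  sym q-hi , sym q-lo , λ k k≢lo k≢hi → sym (q-other k k≢lo k≢hi))

swapped-respˡ : ∀ {i} {p p′ q : Permutation′ (suc n)} → p ≈ p′ → Swapped i p q → Swapped i p′ q
swapped-respˡ p≈p′ (q-lo , q-hi , q-other) =
  trans q-lo (p≈p′ _) , trans q-hi (p≈p′ _) , λ k k≢lo k≢hi → trans (q-other k k≢lo k≢hi) (p≈p′ k)

walk-respˡ : ∀ {k} {p p′ q : Permutation′ (suc n)} → p ≈ p′ → Walk k p q → Walk k p′ q
walk-respˡ p≈p′ (stop p≈q) = stop λ i → trans (sym (p≈p′ i)) (p≈q i)
walk-respˡ {p = p} {p′} p≈p′ (step {q = r} p~r walk) =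
  let (i , swapped) = adjacent⇒swapped p~r
  in step (swapped⇒adjacent p′ r (swapped-respˡ {p = p} {p′} {r} p≈p′ swapped)) walk

infix 4 _≈?_

_≈?_ : (p q : Permutation′ n) → Dec (p ≈ q)
p ≈? q = all? λ i → (p ⟨$⟩ʳ i) ≟ (q ⟨$⟩ʳ i)

-- Up to `≈`, every neighbour of `p` is some `swap i ∘ₚ p`, so finitely many first steps have to be
-- tried.
walk? : ∀ k (p q : Permutation′ (suc n)) → Dec (Walk k p q)
walk? zero p q = map′ stop (λ { (stop p≈q) → p≈q }) (p ≈? q)
walk? (suc k) p q = map′
  (λ (i , walk) → step (swapped⇒adjacent p (swap i ∘ₚ p) (swapped-swap i p)) walk)
  (λ { (step {q = r} p~r walk) → let (i , swapped) = adjacent⇒swapped p~r in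
    i , walk-respˡ {p = r} {swap i ∘ₚ p} (λ j → sym (swapped⇒≈ {p = p} {r} swapped j)) walk })
  (any? λ i → walk? k (swap i ∘ₚ p) q)

≼⇒walk : {p q : Permutation′ (suc n)} → p ≼ q → ∃ λ k → Walk k p q
≼⇒walk ε = zero , stop λ _ → refl
≼⇒walk (_◅_ {i = p} {j = r} (inj₁ p≈r) r≼q) =
  let (k , walk) = ≼⇒walk r≼q in k , walk-respˡ {p = r} {p} (λ i → sym (p≈r i)) walk
≼⇒walk (inj₂ p⋖r ◅ r≼q) = let (k , walk) = ≼⇒walk r≼q in suc k , step (fwd p⋖r) walk

least : {P : Pred ℕ 0ℓ} → Unary.Decidable P → ∀ k → P k → ∃ λ k → P k × (∀ l → P l → k ≤ l)
least {P} P? k = go (ℕ.<-wellFounded k)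
  where
  go : ∀ {k} → Acc ℕ._<_ k → P k → ∃ λ k → P k × (∀ l → P l → k ≤ l)
  go {k} (acc rec) Pk with anyUpTo? P? k
  ... | yes (l , l<k , Pl) = go (rec l<k) Pl
  ... | no none = k , Pk , λ l Pl → ℕ.≮⇒≥ λ l<k → none (l , l<k , Pl)

rank : (p : Permutation′ (suc n)) → ∃ (HasRank p)
rank p = let (k , walk) = ≼⇒walk (id-least p) in least (λ k → walk? k id p) k walk

-- Intersecting families

-- The combinatorial form of "the meet has positive rank", by the two conversions below.
Common : Permutation′ (suc n) → Permutation′ (suc n) → Set
Common x y = ∃ λ i → i Subset.∈ ID x × i Subset.∈ ID y

RankedMeet : Permutation′ n → Permutation′ n → Set
RankedMeet x y = ∃ λ m → IsMeet x y m × ∃ λ k → HasRank m k × 1 ≤ k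

ID≡∅⇒≈id : (p : Permutation′ (suc n)) → (∀ i → ¬ i Subset.∈ ID p) → p ≈ id
ID≡∅⇒≈id p none i = trans (cong (p ⟨$⟩ʳ_) (sym (increasing⇒identity (p ⟨$⟩ˡ_)
  (λ i → ∉ID⁻ p (none i)) i))) (inverseʳ p)

rankedMeet⇒common : {x y : Permutation′ (suc n)} → RankedMeet x y → Common x y
rankedMeet⇒common (m , (m≼x , m≼y , _) , k , (_ , minimal) , 1≤k) with nonempty? (ID m)
... | yes (i , i∈) = i , ≼⇒ID⊆ m≼x i∈ , ≼⇒ID⊆ m≼y i∈
-- Without inverse descents `m` is the identity, which a walk of length 0 reaches.
... | no empty = contradiction (ℕ.≤-trans 1≤k (minimal 0 (stop λ i →
  sym (ID≡∅⇒≈id m (λ i i∈ → empty (i , i∈)) i)))) λ ()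

-- Used to see that a meet lying above some `swap i` is not the identity and so has positive rank.
id-no-descents : ∀ {i : Fin n} → ¬ i Subset.∈ ID {suc n} id
id-no-descents {i = i} i∈ = <-asym (∈ID⁻ id i∈) (inject₁<suc i)

common⇒rankedMeet : {x y : Permutation′ (suc n)} → Common x y → RankedMeet x y
common⇒rankedMeet {n} {x} {y} (i , i∈x , i∈y) = ranked (meet x y)
  where
  ranked : ∃ (IsMeet x y) → RankedMeet x y
  ranked (m , m-meet@(_ , _ , greatest)) =
    let (k , m-rank) = rank m in m , m-meet , k , m-rank , positive m-rank
    where
    swap≼m : swap i ≼ m
    swap≼m = greatest (swap i) (∈ID⇒swap≼ x i∈x) (∈ID⇒swap≼ y i∈y)

    positive : ∀ {k} → HasRank m k → 1 ≤ k
    positive {suc k} _ = s≤s z≤n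
    positive {zero} (stop id≈m , _) = contradiction
      (≼⇒ID⊆ (swap≼m ◅◅ ≈⇒≼ {p = m} {id} (λ j → sym (id≈m j))) (ID-swap i)) id-no-descents

member? : (P : Family n) (p : Permutation′ n) → Dec (p ∈ ⟦ P ⟧)
member? P p = Any.any? (p ≈?_) (elements P)

member-resp-≈ : (P : Family n) {p q : Permutation′ n} → p ≈ q → p ∈ ⟦ P ⟧ → q ∈ ⟦ P ⟧
member-resp-≈ {n} P {p} {q} = Membership.∈-resp-≈ (permSetoid n) {x = p} {q}

common? : (x y : Permutation′ (suc n)) → Dec (Common x y)
common? x y = any? λ i → i ∈? ID x ×-dec i ∈? ID y

common-mono : {x x′ y y′ : Permutation′ (suc n)} → x ≼ x′ → y ≼ y′ → Common x y → Common x′ y′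
common-mono x≼x′ y≼y′ (i , i∈x , i∈y) = i , ≼⇒ID⊆ x≼x′ i∈x , ≼⇒ID⊆ y≼y′ i∈y

common-sym : {x y : Permutation′ (suc n)} → Common x y → Common y x
common-sym (i , i∈x , i∈y) = i , i∈y , i∈x

module _ (P : Family (suc n)) (P-intersecting : IntersectingFamily P) where

  common : ∀ {x y} → x ∈ ⟦ P ⟧ → y ∈ ⟦ P ⟧ → Common x y
  common {x} {y} x∈P y∈P = rankedMeet⇒common {x = x} {y} (P-intersecting x y x∈P y∈P)

  not-both : ∀ {x y} → x ∈ ⟦ P ⟧ → y ∈ ⟦ P ⟧ → ¬ (∀ {i} → i Subset.∈ ID x → ¬ i Subset.∈ ID y)
  not-both {x} {y} x∈P y∈P disjoint =
    let (i , i∈x , i∈y) = common {x} {y} x∈P y∈P in disjoint i∈x i∈y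

  ¬reversed : ∀ p → p ∈ ⟦ P ⟧ → ¬ reversed p ∈ ⟦ P ⟧
  ¬reversed p p∈P rev∈P = not-both {reversed p} {p} rev∈P p∈P (ID-reversed⁻ p)

lookup-injective : ∀ {xs} → Uniqueness.Unique (permSetoid n) xs →
                   ∀ {i j} → lookup xs i ≈ lookup xs j → i ≡ j
lookup-injective (_ ∷ _) {zero} {zero} _ = refl
lookup-injective (x# ∷ _) {zero} {suc j} eq = contradiction eq (All.lookup x# (∈-lookup j))
lookup-injective (x# ∷ _) {suc i} {zero} eq = contradiction (sym ∘ eq) (All.lookup x# (∈-lookup i))
lookup-injective (_ ∷ unique) {suc i} {suc j} eq = cong suc (lookup-injective unique eq)

-- q ↦ q or its reversal, whichever lies in P, is injective on Q because Q does
-- not contain a permutation together with its reversal.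
reversal-complete⇒card-max : (P : Family (suc n)) → (∀ p → p ∈ ⟦ P ⟧ ⊎ reversed p ∈ ⟦ P ⟧) →
                             (Q : Family (suc n)) → IntersectingFamily Q → card Q ≤ card P
reversal-complete⇒card-max {n} P total Q Q-intersecting =
  Fin.injective⇒≤ {f = λ i → index {q i} (total (q i))} λ {i} {j} eq →
    lookup-injective (unique Q)
      (index-injective (q i) (q j) (total (q i)) (total (q j)) (q∈Q i) (q∈Q j) eq)
  where
  q : Fin (card Q) → Permutation′ (suc n)
  q = lookup (elements Q)

  q∈Q : ∀ i → q i ∈ ⟦ Q ⟧
  q∈Q = Membership.∈-lookup (permSetoid (suc n)) (elements Q)

  index : ∀ {p} → p ∈ ⟦ P ⟧ ⊎ reversed p ∈ ⟦ P ⟧ → Fin (card P)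
  index = [ Any.index , Any.index ]′

  ≉reversed : ∀ {x y} → x ∈ ⟦ Q ⟧ → y ∈ ⟦ Q ⟧ → ¬ x ≈ reversed y
  ≉reversed {x} {y} x∈Q y∈Q x≈rev = ¬reversed Q Q-intersecting y y∈Q
    (member-resp-≈ Q {x} {reversed y} x≈rev x∈Q)

  same-index : ∀ {x y} (x∈ : x ∈ ⟦ P ⟧) (y∈ : y ∈ ⟦ P ⟧) → Any.index x∈ ≡ Any.index y∈ → x ≈ y
  same-index {x} {y} = Membership.index-injective (permSetoid (suc n)) {x} {y}

  index-injective : ∀ x y (x∈ : x ∈ ⟦ P ⟧ ⊎ reversed x ∈ ⟦ P ⟧)
                    (y∈ : y ∈ ⟦ P ⟧ ⊎ reversed y ∈ ⟦ P ⟧) →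
                    x ∈ ⟦ Q ⟧ → y ∈ ⟦ Q ⟧ → index {x} x∈ ≡ index {y} y∈ → x ≈ y
  index-injective x y (inj₁ x∈) (inj₁ y∈) _ _ eq = same-index {x} {y} x∈ y∈ eq
  -- Equal indices would make `x` the reversal of `y`, and `Q` would contain both.
  index-injective x y (inj₁ x∈) (inj₂ y∈) x∈Q y∈Q eq =
    contradiction (same-index {x} {reversed y} x∈ y∈ eq) (≉reversed {x} {y} x∈Q y∈Q)
  index-injective x y (inj₂ x∈) (inj₁ y∈) x∈Q y∈Q eq =
    contradiction (same-index {y} {reversed x} y∈ x∈ (sym eq)) (≉reversed {y} {x} y∈Q x∈Q)
  -- Evaluating the equality of the reversals at `opposite i` undoes the reversal.
  index-injective x y (inj₂ x∈) (inj₂ y∈) _ _ eq i = subst (λ j → x ⟨$⟩ʳ j ≡ y ⟨$⟩ʳ j)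
    (Fin.opposite-involutive i) (same-index {reversed x} {reversed y} x∈ y∈ eq (opposite i))

-- Maximum families.

module _ (P : Family (suc n)) (P-maximum : Maximum P) where

  private
    P-intersecting : IntersectingFamily P
    P-intersecting = proj₁ P-maximum

  -- Otherwise adding `p` would give a larger intersecting family. `Common p p` is required because
  -- members must also intersect themselves.
  extend : ∀ p → Common p p → (∀ x → x ∈ ⟦ P ⟧ → Common p x) → p ∈ ⟦ P ⟧
  extend p p-p p-P with member? P p
  ... | yes p∈P = p∈P
  ... | no p∉P = contradiction (proj₂ P-maximum Q Q-intersecting) ℕ.1+n≰n
    where
    Q : Family (suc n)
    Q = record { elements = p ∷ elements P ; unique = ¬Any⇒All¬ _ p∉P ∷ unique P }

    Q-intersecting : IntersectingFamily Q
    Q-intersecting x y (here x≈p) (here y≈p) = common⇒rankedMeet {x = x} {y}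
      (common-mono {x = p} {x} {p} {y} (≈⇒≼ {p = p} {x} (sym ∘ x≈p))
        (≈⇒≼ {p = p} {y} (sym ∘ y≈p)) p-p)
    Q-intersecting x y (here x≈p) (there y∈P) = common⇒rankedMeet {x = x} {y}
      (common-mono {x = p} {x} {y} {y} (≈⇒≼ {p = p} {x} (sym ∘ x≈p)) ε (p-P y y∈P))
    Q-intersecting x y (there x∈P) (here y≈p) = common⇒rankedMeet {x = x} {y}
      (common-sym {x = y} {x} (common-mono {x = p} {y} {x} {x}
        (≈⇒≼ {p = p} {y} (sym ∘ y≈p)) ε (p-P x x∈P)))
    Q-intersecting x y (there x∈P) (there y∈P) = P-intersecting x y x∈P y∈P

  -- If `p` has nothing in common with some member `x`, then `ID x` lies in the complement of
  -- `ID p`, so the reversal meets every member because `x` does.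
  reversal-complete : Fin n → ∀ p → p ∈ ⟦ P ⟧ ⊎ reversed p ∈ ⟦ P ⟧
  reversal-complete i₀ p with nonempty? (ID p)
  -- The reversal has every index as an inverse descent; `i₀` shows that there is one.
  ... | no empty = inj₂ (extend (reversed p) (i₀ , full i₀ , full i₀) λ x x∈P →
    let (i , i∈x , _) = common P P-intersecting {x} {x} x∈P x∈P in i , full i , i∈x)
    where
    full : ∀ i → i Subset.∈ ID (reversed p)
    full i = ID-reversed⁺ p λ i∈ → empty (i , i∈)
  ... | yes (i , i∈) with All.all? (common? p) (elements P)
  ...   | yes all = inj₁ (extend p (i , i∈ , i∈) λ x x∈P → All.lookupWith
    (λ {y} p-y x≈y → common-mono {x = p} {p} {y} {x} ε (≈⇒≼ {p = y} {x} (sym ∘ x≈y)) p-y) all x∈P)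
  ...   | no ¬all = inj₂ (reversed∈P
    (Membership.find (permSetoid (suc n)) (¬All⇒Any¬ (common? p) _ ¬all)))
    where
    reversed∈P : ∃ (λ x → x ∈ ⟦ P ⟧ × ¬ Common p x) → reversed p ∈ ⟦ P ⟧
    reversed∈P (x , x∈P , ¬common) = extend (reversed p)
      (let (j , j∈x , _) = common P P-intersecting {x} {x} x∈P x∈P in j , from-x j∈x , from-x j∈x)
      λ y y∈P → let (j , j∈x , j∈y) = common P P-intersecting {x} {y} x∈P y∈P
                in j , from-x j∈x , j∈y
      where
      from-x : ID x Subset.⊆ ID (reversed p)
      from-x {j} j∈x = ID-reversed⁺ p λ j∈p → ¬common (j , j∈p , j∈x)

  module _ (i₀ : Fin n) where

    -- Otherwise the reversal of `z` is a member, and its inverse descents avoid `ID z` and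
    -- therefore `ID x`.
    ID-closed : ∀ {x} z → x ∈ ⟦ P ⟧ → ID x Subset.⊆ ID z → z ∈ ⟦ P ⟧
    ID-closed {x} z x∈P ⊆z with reversal-complete i₀ z
    ... | inj₁ z∈P = z∈P
    ... | inj₂ rev∈P = contradiction (λ {i} i∈rev i∈x → ID-reversed⁻ z {i} i∈rev (⊆z i∈x))
      (not-both P P-intersecting {reversed z} {x} rev∈P x∈P)

    π-ID∈ : ∀ {x} → x ∈ ⟦ P ⟧ → π (ID x) ∈ ⟦ P ⟧
    π-ID∈ {x} x∈P = ID-closed {x} (π (ID x)) x∈P
      (subst (ID x Subset.⊆_) (sym (ID-π (ID x))) λ i∈ → i∈)

    -- Descend through proper subsets `B` with `π B` in the family. When none is left, a member `q`
    -- below `π A` has `ID q` equal to `A`, as `π (ID q)` is a member too.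
    minimal-below : ∀ A → π A ∈ ⟦ P ⟧ → ∃ λ B → B Subset.⊆ A × π B ∈ minimals ⟦ P ⟧
    minimal-below A = go (⊂-wellFounded A)
      where
      go : ∀ {A} → Acc Subset._⊂_ A → π A ∈ ⟦ P ⟧ → ∃ λ B → B Subset.⊆ A × π B ∈ minimals ⟦ P ⟧
      go {A} (acc rec) πA∈P with anySubset? (λ B → B ⊂? A ×-dec member? P (π B))
      ... | yes (B , B⊂A , πB∈P) = let (C , C⊆B , minimal) = go (rec B⊂A) πB∈P in
        C , proj₁ B⊂A ∘ C⊆B , minimal
      ... | no none = A , (λ i∈A → i∈A) , πA∈P , λ q q∈P q≼πA →
        let ID⊆A : ID q Subset.⊆ A
            ID⊆A = subst (ID q Subset.⊆_) (ID-π A) (≼⇒ID⊆ q≼πA)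
            A⊆ID : A Subset.⊆ ID q
            A⊆ID {i} i∈A = decidable-stable (i ∈? ID q) λ i∉ID → none (ID q ,
              (ID⊆A , i , i∈A , i∉ID) , π-ID∈ {q} q∈P)
        in ≼-antisym q≼πA (π-least A q A⊆ID)

    generator-below : ∀ {x} → x ∈ ⟦ P ⟧ → ∃ λ B → B Subset.⊆ ID x × B ∈ IDs (minimals ⟦ P ⟧)
    generator-below {x} x∈P = let (B , B⊆ , minimal) = minimal-below (ID x) (π-ID∈ {x} x∈P)
      in B , B⊆ , π B , minimal , ID-π B

    maximum⇒antichain : MaximalIntersectingAntichain (IDs (minimals ⟦ P ⟧))
    maximum⇒antichain = record
      { intersecting = λ { _ _ (p , (p∈P , _) , refl) (q , (q∈P , _) , refl) →
          let (i , i∈p , i∈q) = common P P-intersecting {p} {q} p∈P q∈P in i , x∈p∩q⁺ (i∈p , i∈q) }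
      -- The member `π (ID p)` lies below the minimal `q`, so the two agree and `ID q` is `ID p`.
      ; antichain = λ { _ _ (p , (p∈P , _) , refl) (q , (_ , q-minimal) , refl) p⊆q → ⊆-antisym p⊆q
          (subst (ID q Subset.⊆_) (ID-π (ID p)) (≼⇒ID⊆ (≈⇒≼ {p = q} {π (ID p)} (sym ∘
            q-minimal (π (ID p)) (π-ID∈ {p} p∈P) (π-least (ID p) q p⊆q))))) }
      ; maximal = λ B _ → maximal B (reversal-complete i₀ (π B))
      }
      where
      maximal : ∀ B → π B ∈ ⟦ P ⟧ ⊎ reversed (π B) ∈ ⟦ P ⟧ →
                ∃ λ A → A ∈ IDs (minimals ⟦ P ⟧) × (Empty (A Subset.∩ B) ⊎ A Subset.⊆ B)
      maximal B (inj₁ πB∈P) = let (A , A⊆ , A∈) = generator-below {π B} πB∈P in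
        A , A∈ , inj₂ (subst (A Subset.⊆_) (ID-π B) A⊆)
      -- The reversal of `π B` has the complement of `B` as its inverse descent set, so a generator
      -- inside it misses `B`.
      maximal B (inj₂ rev∈P) = let (A , A⊆ , A∈) = generator-below {reversed (π B)} rev∈P in
        A , A∈ , inj₁ λ (i , i∈∩) → let (i∈A , i∈B) = x∈p∩q⁻ A B i∈∩ in
          ID-reversed⁻ (π B) (A⊆ i∈A) (subst (i Subset.∈_) (sym (ID-π B)) i∈B)

    -- A member lies above `π B` for a generator `B` inside its inverse descent set. Conversely,
    -- anything above a join of `ID p` has `ID p` among its inverse descents, and `ID-closed`
    -- applies.
    maximum⇒≐𝒫 : ⟦ P ⟧ ≐ 𝒫 (IDs (minimals ⟦ P ⟧))
    maximum⇒≐𝒫 =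
      (λ {x} x∈P → let (B , B⊆ , B∈) = generator-below {x} x∈P in
        π B , (B , B∈ , Isπ-π B) , π-least B x B⊆) ,
      λ { {z} (x , (_ , (p , (p∈P , _) , refl) , isπ) , x≼z) →
        ID-closed {p} z p∈P (≼⇒ID⊆ x≼z ∘ Isπ⇒⊆ID {x = x} isπ) }

-- From a maximal intersecting antichain to a maximum family.

𝒫⇒reversal-complete : {𝒜 : System (suc n)} {F : Pred (Permutation′ (suc n)) 0ℓ} →
                      Unary.Decidable F → MaximalIntersectingAntichain 𝒜 →
                      𝒫 𝒜 Unary.⊆ F → ∀ p → p ∈ F ⊎ reversed p ∈ F
𝒫⇒reversal-complete {𝒜 = 𝒜} {F} F? mia 𝒫⊆F p with F? p | F? (reversed p)
... | yes p∈F | _ = inj₁ p∈F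
... | no _ | yes rev∈F = inj₂ rev∈F
... | no p∉F | no rev∉F = contradiction
  -- Maximality at `ID p` gives a generator inside `ID p`, which forces `p` into `F`, or one inside
  -- its complement, which forces the reversal.
  (maximal (ID p) λ ID∈𝒜 → p∉F (∈F (ID p) p ID∈𝒜 λ i∈ → i∈)) λ where
    (A , A∈𝒜 , inj₁ disjoint) → rev∉F (∈F A (reversed p) A∈𝒜 λ {i} i∈A →
      ID-reversed⁺ p λ i∈p → disjoint (i , x∈p∩q⁺ (i∈A , i∈p)))
    (A , A∈𝒜 , inj₂ A⊆ID) → p∉F (∈F A p A∈𝒜 A⊆ID)
  where
  open MaximalIntersectingAntichain mia

  ∈F : ∀ A q → A ∈ 𝒜 → A Subset.⊆ ID q → q ∈ F
  ∈F A q A∈𝒜 A⊆ID = 𝒫⊆F (π A , (A , A∈𝒜 , Isπ-π A) , π-least A q A⊆ID)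

theorem4p10 : (n : ℕ) → 2 ≤ n →
    (P : Family n) → IntersectingFamily P →
    let 𝒜 = IDs (minimals ⟦ P ⟧) in
    Maximum P ⇔ (MaximalIntersectingAntichain 𝒜 × ⟦ P ⟧ ≐ 𝒫 𝒜)
theorem4p10 (suc (suc n)) _ P P-intersecting = mk⇔
  -- Since the size is at least 2 there is a generator; `zero` is its index.
  (λ maximum → maximum⇒antichain P maximum zero , maximum⇒≐𝒫 P maximum zero)
  (λ (mia , _ , 𝒫⊆P) → P-intersecting ,
    reversal-complete⇒card-max P (𝒫⇒reversal-complete (member? P) mia 𝒫⊆P))
theorem4p10 (suc zero) (s≤s ())
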